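{- The following equalities of classes hold: $$\begin{aligned}\mathbb{K}_{\mathbf{CPL}_{\mathbf e}}&=\{\mathcal{B}\in\mathbb{K}_{\mathbf{Ci}}:\mathcal{M}(\mathcal{B})\text{ validates }(\mathbf{cons})\}\\&=\{\mathcal{B}\in\mathbb{K}_{\mathbf{mbC}}:\mathcal{M}(\mathcal{B})\text{ validates }(\mathbf{cons})\}\\&=\{\mathcal{B}\in\mathbb{K}_{\mathbf{CPL}^+_{\mathbf e}}:\mathcal{M}(\mathcal{B})\text{ validates }(\mathbf{Ax10}),(\mathbf{bc1})\text{ and }(\mathbf{cons})\}.\end{aligned}$$
   Context: Let $\Sigma=\{\wedge,\vee,\to,\neg,\circ\}$ ($\neg,\circ$ unary, the others binary); $For(\Sigma)$ is the set of formulas over $\Sigma$ generated by a denumerable set of propositional variables. A multialgebra over $\Sigma$ is a nonempty set with operations whose values are nonempty subsets. For a Boolean algebra $\mathcal{A}$ with domain $A$ (the one-element Boolean algebra is allowed) and $z\in A^3$ write $z=(z_1,z_2,z_3)$; $\sim$ is Boolean complement. A swap structure for $\mathbf{CPL}^+_{\mathbf e}$ over $\mathcal{A}$ is a multialgebra $\mathcal{B}$ over $\Sigma$ with domain $|\mathcal{B}|=B\subseteq A^3$ such that $0\in\{z_1:z\in B\}$ and for all $z,w\in B$: $\emptyset\ne z\#w\subseteq\{u\in B: u_1=z_1\# w_1\}$ for $\#\in\{\wedge,\vee,\to\}$; $\emptyset\neq\neg z\subseteq\{u\in B:u_1=z_2\}$; $\emptyset\ne\circ z\subseteq\{u\in B:u_1=z_3\}$.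 $\mathbb{K}_{\mathbf{CPL}^+_{\mathbf e}}$ is the class of all of these, over arbitrary Boolean algebras. $\mathbb{K}_{\mathbf{mbC}}$ consists of those with $B\subseteq\{z\in A^3: z_1\vee z_2=1,\ z_1\wedge z_2\wedge z_3=0\}$. $\mathbb{K}_{\mathbf{Ci}}$ consists of those with $B\subseteq\{z\in A^3: z_1\vee z_2=1,\ z_3={\sim}(z_1\wedge z_2)\}$ such that for all $z\in B$: $\circ z=\{({\sim}(z_1\wedge z_2),z_1\wedge z_2,1)\}$ and $\neg z\subseteq\{u\in B:u_1=z_2\text{ and }u_2\le z_1\}$. $\mathbb{K}_{\mathbf{CPL}_{\mathbf e}}$ consists of those $\mathcal{B}\in\mathbb{K}_{\mathbf{Ci}}$ with $B\subseteq\{(a,{\sim}a,1):a\in A\}$. $\mathcal{M}(\mathcal{B})=(\mathcal{B},D_{\mathcal{B}})$ is the Nmatrix with designated set $D_{\mathcal{B}}=\{z\in B: z_1=1\}$. A valuation over $\mathcal{M}(\mathcal{B})$ is $v:For(\Sigma)\to B$ with $v(\alpha\#\beta)\in v(\alpha)\#v(\beta)$, $v(\neg\alpha)\in\neg v(\alpha)$, $v(\circ\alpha)\in\circ v(\alpha)$. $\mathcal{M}(\mathcal{B})$ validates an axiom schema if $v(\gamma)\in D_{\mathcal{B}}$ for every instance $\gamma$ and every valuation $v$. The schemas are: $(\mathbf{Ax10})$ $\alpha\vee\neg\alpha$; $(\mathbf{bc1})$ $\circ\alpha\to(\alpha\to(\neg\alpha\to\beta))$; $(\mathbf{cons})$ $\circ\alpha$.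 -}

module Defs where

open import Level using (Level; _⊔_; suc)
open import Algebra.Core using (Op₂)
open import Algebra.Lattice.Bundles using (BooleanAlgebra)
import Algebra.Lattice.Properties.Lattice as LatticeProperties
open import Data.Nat.Base using (ℕ)
open import Data.Product.Base using (Σ; ∃; ∃-syntax; _×_; _,_; proj₁; proj₂)
open import Data.Product.Relation.Binary.Pointwise.NonDependent using (_×ₛ_)
open import Relation.Binary.Bundles using (Setoid; Poset)
open import Relation.Binary.Definitions using (_Respects_)
import Relation.Binary.Construct.On as On
open import Relation.Binary.PropositionalEquality.Core using (_≡_)
open import Relation.Unary using (Pred; _∈_; _⊆_; _≐_; Satisfiable)

private
  variable
    c a ℓ b r : Level

data Unary : Set where
  neg circ : Unary

data Binary : Set where
  conj disj impl : Binary

data Formula : Set where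
  var : ℕ → Formula
  un  : Unary → Formula → Formula
  bin : Binary → Formula → Formula → Formula

infix  8 ¬̇_ ∘̇_
infixr 7 _∧̇_
infixr 6 _∨̇_
infixr 5 _→̇_

¬̇_ ∘̇_ : Formula → Formula
¬̇_ = un neg
∘̇_ = un circ

_∧̇_ _∨̇_ _→̇_ : Formula → Formula → Formula
_∧̇_ = bin conj
_∨̇_ = bin disj
_→̇_ = bin impl

-- A schema is the set of its instances.
Schema : Set₁
Schema = Pred Formula Level.zero

Ax10 bc1 cons : Schema
Ax10 γ = ∃[ α ] γ ≡ α ∨̇ ¬̇ α
bc1  γ = ∃[ α ] ∃[ β ] γ ≡ ∘̇ α →̇ (α →̇ (¬̇ α →̇ β))
cons γ = ∃[ α ] γ ≡ ∘̇ α

-- The domain is a setoid, so multioperations have to respect its equality,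
-- both in the arguments and in the subset returned.
record Multialgebra (S : Setoid c ℓ) (r : Level) : Set (c ⊔ ℓ ⊔ suc r) where
  open Setoid S using (Carrier; _≈_)
  field
    op₁       : Unary → Carrier → Pred Carrier r
    op₂       : Binary → Carrier → Carrier → Pred Carrier r
    op₁-cong  : ∀ # {x x′ u u′} → x ≈ x′ → u ≈ u′ →
                u ∈ op₁ # x → u′ ∈ op₁ # x′
    op₂-cong  : ∀ # {x x′ y y′ u u′} → x ≈ x′ → y ≈ y′ → u ≈ u′ →
                u ∈ op₂ # x y → u′ ∈ op₂ # x′ y′
    inhabited : Carrier
    op₁-nonempty : ∀ # x → Satisfiable (op₁ # x)
    op₂-nonempty : ∀ # x y → Satisfiable (op₂ # x y)

module Triples (𝒜 : BooleanAlgebra a ℓ) where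
  open BooleanAlgebra 𝒜 public
    using (Carrier; _≈_; _∨_; _∧_; setoid; lattice)
    renaming (¬_ to ∼_; ⊤ to 1#; ⊥ to 0#)
  open Poset (LatticeProperties.poset lattice) public using (_≤_)

  tripleSetoid : Setoid a ℓ
  tripleSetoid = setoid ×ₛ (setoid ×ₛ setoid)

  open Setoid tripleSetoid public
    using () renaming (Carrier to Triple; _≈_ to _≈³_)

  infix 9 _₁ _₂ _₃

  _₁ _₂ _₃ : Triple → Carrier
  z ₁ = proj₁ z
  z ₂ = proj₁ (proj₂ z)
  z ₃ = proj₂ (proj₂ z)

  ⟦_⟧ : Binary → Op₂ Carrier
  ⟦ conj ⟧ x y = x ∧ y
  ⟦ disj ⟧ x y = x ∨ y
  ⟦ impl ⟧ x y = ∼ x ∨ y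

-- A Boolean algebra 𝒜 together with a multialgebra whose domain is a subset B
-- of A³; the classes below are classes of such structures.
record TripleMultialgebra (a ℓ b r : Level) : Set (suc (a ⊔ ℓ ⊔ b ⊔ r)) where
  field
    𝒜 : BooleanAlgebra a ℓ

  open Triples 𝒜 public

  field
    B      : Pred Triple b
    B-resp : B Respects _≈³_

  Dom : Set (a ⊔ b)
  Dom = Σ Triple B

  -- Elements of B are compared as triples, ignoring membership proofs.
  domain : Setoid (a ⊔ b) ℓ
  domain = On.setoid {B = Dom} tripleSetoid proj₁

  field
    multialgebra : Multialgebra domain r

  open Multialgebra multialgebra public

  D : Pred Dom ℓ
  D (z , _) = z ₁ ≈ 1#

record Valuation (𝓑 : TripleMultialgebra a ℓ b r) : Set (a ⊔ b ⊔ r) where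
  open TripleMultialgebra 𝓑
  field
    val   : Formula → Dom
    val-un  : ∀ # α → val (un # α) ∈ op₁ # (val α)
    val-bin : ∀ # α β → val (bin # α β) ∈ op₂ # (val α) (val β)

Validates : Schema → Pred (TripleMultialgebra a ℓ b r) (a ⊔ ℓ ⊔ b ⊔ r)
Validates ax 𝓑 = ∀ γ → γ ∈ ax → (v : Valuation 𝓑) → Valuation.val v γ ∈ D
  where open TripleMultialgebra 𝓑

record 𝕂-CPL⁺ₑ (𝓑 : TripleMultialgebra a ℓ b r) : Set (a ⊔ ℓ ⊔ b ⊔ r) where
  open TripleMultialgebra 𝓑
  field
    zero∈   : ∃[ z ] (z ∈ B × z ₁ ≈ 0#)
    bin-sub : ∀ # (z w : Dom) →
              op₂ # z w ⊆ λ u → proj₁ u ₁ ≈ ⟦ # ⟧ (proj₁ z ₁) (proj₁ w ₁)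
    neg-sub : ∀ (z : Dom) → op₁ neg z ⊆ λ u → proj₁ u ₁ ≈ proj₁ z ₂
    circ-sub : ∀ (z : Dom) → op₁ circ z ⊆ λ u → proj₁ u ₁ ≈ proj₁ z ₃

record 𝕂-mbC (𝓑 : TripleMultialgebra a ℓ b r) : Set (a ⊔ ℓ ⊔ b ⊔ r) where
  open TripleMultialgebra 𝓑
  field
    swap  : 𝕂-CPL⁺ₑ 𝓑
    B-sub : B ⊆ λ z → z ₁ ∨ z ₂ ≈ 1# × (z ₁ ∧ z ₂) ∧ z ₃ ≈ 0#

record 𝕂-Ci (𝓑 : TripleMultialgebra a ℓ b r) : Set (a ⊔ ℓ ⊔ b ⊔ r) where
  open TripleMultialgebra 𝓑
  field
    swap    : 𝕂-CPL⁺ₑ 𝓑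
    B-sub   : B ⊆ λ z → z ₁ ∨ z ₂ ≈ 1# × z ₃ ≈ ∼ (z ₁ ∧ z ₂)
    -- As op₁ circ z is nonempty, this also says that the triple lies in B.
    circ-eq : ∀ ((z , z∈B) : Dom) →
              op₁ circ (z , z∈B) ≐
                λ u → proj₁ u ≈³ (∼ (z ₁ ∧ z ₂) , z ₁ ∧ z ₂ , 1#)
    neg-sub : ∀ ((z , z∈B) : Dom) →
              op₁ neg (z , z∈B) ⊆ λ u → proj₁ u ₁ ≈ z ₂ × proj₁ u ₂ ≤ z ₁

record 𝕂-CPLₑ (𝓑 : TripleMultialgebra a ℓ b r) : Set (a ⊔ ℓ ⊔ b ⊔ r) where
  open TripleMultialgebra 𝓑
  field
    ci    : 𝕂-Ci 𝓑
    B-sub : B ⊆ λ z → ∃[ x ] z ≈³ (x , ∼ x , 1#)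

{-# OPTIONS --safe #-}
module Submission where

-- In a swap structure, an arbitrary assignment of snapshots to the variables
-- extends to a valuation, since all multioperations are nonempty. Hence a schema
-- is validated exactly when the first coordinate forced on it is 1 at every
-- snapshot z: (Ax10) means z₁ ∨ z₂ = 1, (bc1) means z₁ ∧ z₂ ∧ z₃ = 0 (evaluate β
-- at a snapshot with first coordinate 0), and (cons) means z₃ = 1. Together the
-- three conditions say that z₂ is the complement of z₁ and z₃ = 1.

open import Defs
open import Level using (Level)
open import Algebra.Lattice.Bundles using (BooleanAlgebra)
import Algebra.Lattice.Properties.BooleanAlgebra as BooleanAlgebraProperties
open import Data.Nat.Base using (ℕ; zero; suc)
open import Data.Product.Base using (_×_; _,_; proj₁; proj₂)
open import Function.Bundles using (_⇔_; mk⇔; Equivalence)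
open import Relation.Binary.Bundles using (Setoid)
import Relation.Binary.Reasoning.Setoid as SetoidReasoning
open import Relation.Binary.PropositionalEquality.Core using (refl)
open import Relation.Unary using (_⊆_; _∩_; _≐_)

open Equivalence using (to; from)

private
  variable
    a ℓ b r : Level

-- Boolean algebra: complements and curried implications.

module _ (𝒜 : BooleanAlgebra a ℓ) where
  open BooleanAlgebra 𝒜 hiding (refl)
  open BooleanAlgebraProperties 𝒜
  open SetoidReasoning setoid

  -- Both sides equal `y ∧ ¬ x`: splitting `y` along `x ∨ ¬ x` leaves only that part because
  -- `x ∧ y ≈ ⊥`, and splitting `¬ x` along `x ∨ y ≈ ⊤` leaves only that part because `x ∧ ¬ x ≈ ⊥`.
  complement-unique : ∀ {x y} → x ∨ y ≈ ⊤ → x ∧ y ≈ ⊥ → y ≈ ¬ x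
  complement-unique {x} {y} x∨y≈⊤ x∧y≈⊥ = begin
    y                    ≈⟨ ∧-identityʳ y ⟨
    y ∧ ⊤                ≈⟨ ∧-congˡ (∨-complementʳ x) ⟨
    y ∧ (x ∨ ¬ x)        ≈⟨ ∧-distribˡ-∨ y x (¬ x) ⟩
    y ∧ x ∨ y ∧ ¬ x      ≈⟨ ∨-congʳ (trans (∧-comm y x) x∧y≈⊥) ⟩
    ⊥ ∨ y ∧ ¬ x          ≈⟨ ∨-congʳ (∧-complementʳ x) ⟨
    x ∧ ¬ x ∨ y ∧ ¬ x    ≈⟨ ∧-distribʳ-∨ (¬ x) x y ⟨
    (x ∨ y) ∧ ¬ x        ≈⟨ ∧-congʳ x∨y≈⊤ ⟩
    ⊤ ∧ ¬ x              ≈⟨ ∧-identityˡ (¬ x) ⟩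
    ¬ x                  ∎

  ¬x≈⊤⇒x≈⊥ : ∀ {x} → ¬ x ≈ ⊤ → x ≈ ⊥
  ¬x≈⊤⇒x≈⊥ {x} ¬x≈⊤ = begin
    x      ≈⟨ ¬-involutive x ⟨
    ¬ ¬ x  ≈⟨ ¬-cong ¬x≈⊤ ⟩
    ¬ ⊤    ≈⟨ ¬⊤≈⊥ ⟩
    ⊥      ∎

  x≈⊥⇒¬x≈⊤ : ∀ {x} → x ≈ ⊥ → ¬ x ≈ ⊤
  x≈⊥⇒¬x≈⊤ x≈⊥ = trans (¬-cong x≈⊥) ¬⊥≈⊤

  -- Uncurrying by De Morgan. The left side takes the premises in the order of (bc1), with `z`, `x`,
  -- `y` for `∘̇ α`, `α`, `¬̇ α`; the right side groups them as in the condition defining `𝕂-mbC`.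
  impl-curry : ∀ x y z w →
               ¬ z ∨ (¬ x ∨ (¬ y ∨ w)) ≈ ¬ ((x ∧ y) ∧ z) ∨ w
  impl-curry x y z w = begin
    ¬ z ∨ (¬ x ∨ (¬ y ∨ w))    ≈⟨ ∨-congˡ (∨-assoc (¬ x) (¬ y) w) ⟨
    ¬ z ∨ ((¬ x ∨ ¬ y) ∨ w)    ≈⟨ ∨-assoc (¬ z) (¬ x ∨ ¬ y) w ⟨
    (¬ z ∨ (¬ x ∨ ¬ y)) ∨ w    ≈⟨ ∨-congʳ (∨-comm (¬ z) (¬ x ∨ ¬ y)) ⟩
    ((¬ x ∨ ¬ y) ∨ ¬ z) ∨ w    ≈⟨ ∨-congʳ (∨-congʳ (deMorgan₁ x y)) ⟨
    (¬ (x ∧ y) ∨ ¬ z) ∨ w      ≈⟨ ∨-congʳ (deMorgan₁ (x ∧ y) z) ⟨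
    ¬ ((x ∧ y) ∧ z) ∨ w        ∎

module _ (𝓑 : TripleMultialgebra a ℓ b r) where
  open TripleMultialgebra 𝓑

  -- `Satisfiable` carries a witness, so recursion on formulas selects the values with no appeal to
  -- choice.
  extend : (ℕ → Dom) → Valuation 𝓑
  extend f = record
    { val     = val
    ; val-un  = λ # α → proj₂ (op₁-nonempty # (val α))
    ; val-bin = λ # α β → proj₂ (op₂-nonempty # (val α) (val β))
    }
    where
    val : Formula → Dom
    val (var n)     = f n
    val (un # α)    = proj₁ (op₁-nonempty # (val α))
    val (bin # α β) = proj₁ (op₂-nonempty # (val α) (val β))

-- Schemas as equations on snapshots.

module _ {𝓑 : TripleMultialgebra a ℓ b r} (swap : 𝕂-CPL⁺ₑ 𝓑) where
  open TripleMultialgebra 𝓑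
  open 𝕂-CPL⁺ₑ swap
  open BooleanAlgebra 𝒜
    using (sym; trans; ∨-cong; ∨-congˡ; ∨-congʳ; ¬-cong)
  open BooleanAlgebraProperties 𝒜 using (∨-identityʳ; ∨-zeroˡ)
  open SetoidReasoning setoid

  module _ (v : Valuation 𝓑) where
    open Valuation v

    val₁ val₂ val₃ : Formula → Carrier
    val₁ α = proj₁ (val α) ₁
    val₂ α = proj₁ (val α) ₂
    val₃ α = proj₁ (val α) ₃

    val₁-bin : ∀ # α β → val₁ (bin # α β) ≈ ⟦ # ⟧ (val₁ α) (val₁ β)
    val₁-bin # α β = bin-sub # (val α) (val β) (val-bin # α β)

    val₁-neg : ∀ α → val₁ (¬̇ α) ≈ val₂ α
    val₁-neg α = neg-sub (val α) (val-un neg α)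

    val₁-circ : ∀ α → val₁ (∘̇ α) ≈ val₃ α
    val₁-circ α = circ-sub (val α) (val-un circ α)

    val₁-Ax10 : ∀ α → val₁ (α ∨̇ ¬̇ α) ≈ val₁ α ∨ val₂ α
    val₁-Ax10 α = trans (val₁-bin disj α (¬̇ α)) (∨-congˡ (val₁-neg α))

    val₁-bc1 : ∀ α β → val₁ (∘̇ α →̇ (α →̇ (¬̇ α →̇ β)))
                       ≈ ∼ ((val₁ α ∧ val₂ α) ∧ val₃ α) ∨ val₁ β
    val₁-bc1 α β = begin
      val₁ (∘̇ α →̇ (α →̇ (¬̇ α →̇ β)))
        ≈⟨ val₁-bin impl (∘̇ α) (α →̇ (¬̇ α →̇ β)) ⟩
      ∼ val₁ (∘̇ α) ∨ val₁ (α →̇ (¬̇ α →̇ β))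
        ≈⟨ ∨-cong (¬-cong (val₁-circ α)) (val₁-bin impl α (¬̇ α →̇ β)) ⟩
      ∼ val₃ α ∨ (∼ val₁ α ∨ val₁ (¬̇ α →̇ β))
        ≈⟨ ∨-congˡ (∨-congˡ (val₁-bin impl (¬̇ α) β)) ⟩
      ∼ val₃ α ∨ (∼ val₁ α ∨ (∼ val₁ (¬̇ α) ∨ val₁ β))
        ≈⟨ ∨-congˡ (∨-congˡ (∨-congʳ (¬-cong (val₁-neg α)))) ⟩
      ∼ val₃ α ∨ (∼ val₁ α ∨ (∼ val₂ α ∨ val₁ β))
        ≈⟨ impl-curry 𝒜 (val₁ α) (val₂ α) (val₃ α) (val₁ β) ⟩
      ∼ ((val₁ α ∧ val₂ α) ∧ val₃ α) ∨ val₁ β ∎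

  -- One variable suffices for necessity: a constant assignment gives `var 0` the value `z`.
  -- Conversely, every `val α` is itself a member of `B`, so the equation applies to it.
  validates-cons⇔ : Validates cons 𝓑 ⇔ (B ⊆ λ z → z ₃ ≈ 1#)
  validates-cons⇔ = mk⇔
    (λ valid {z} z∈B → let v = extend 𝓑 (λ _ → z , z∈B) in
      trans (sym (val₁-circ v (var 0))) (valid _ (var 0 , refl) v))
    (λ { z₃≈1 _ (α , refl) v →
      trans (val₁-circ v α) (z₃≈1 (proj₂ (Valuation.val v α))) })

  validates-Ax10⇔ : Validates Ax10 𝓑 ⇔ (B ⊆ λ z → z ₁ ∨ z ₂ ≈ 1#)
  validates-Ax10⇔ = mk⇔
    (λ valid {z} z∈B → let v = extend 𝓑 (λ _ → z , z∈B) in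
      trans (sym (val₁-Ax10 v (var 0))) (valid _ (var 0 , refl) v))
    (λ { z₁∨z₂≈1 _ (α , refl) v →
      trans (val₁-Ax10 v α) (z₁∨z₂≈1 (proj₂ (Valuation.val v α))) })

  validates-bc1⇔ : Validates bc1 𝓑 ⇔ (B ⊆ λ z → (z ₁ ∧ z ₂) ∧ z ₃ ≈ 0#)
  validates-bc1⇔ = mk⇔ forced sufficient
    where
    forced : Validates bc1 𝓑 → B ⊆ λ z → (z ₁ ∧ z ₂) ∧ z ₃ ≈ 0#
    forced valid {z} z∈B with zero∈
    ... | w , w∈B , w₁≈0 = ¬x≈⊤⇒x≈⊥ 𝒜 (begin
      ∼ ((z ₁ ∧ z ₂) ∧ z ₃)         ≈⟨ ∨-identityʳ _ ⟨
      ∼ ((z ₁ ∧ z ₂) ∧ z ₃) ∨ 0#    ≈⟨ ∨-congˡ w₁≈0 ⟨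
      ∼ ((z ₁ ∧ z ₂) ∧ z ₃) ∨ w ₁   ≈⟨ val₁-bc1 v (var 0) (var 1) ⟨
      val₁ v γ                      ≈⟨ valid γ (var 0 , var 1 , refl) v ⟩
      1#                            ∎)
      where
      -- `var 0` stands for `α` and `var 1` for `β`; as `w ₁ ≈ 0#`, the disjunct coming from `β`
      -- vanishes.
      assign : ℕ → Dom
      assign zero    = z , z∈B
      assign (suc _) = w , w∈B

      v : Valuation 𝓑
      v = extend 𝓑 assign

      γ : Formula
      γ = ∘̇ var 0 →̇ (var 0 →̇ (¬̇ var 0 →̇ var 1))

    sufficient : (B ⊆ λ z → (z ₁ ∧ z ₂) ∧ z ₃ ≈ 0#) → Validates bc1 𝓑
    sufficient z₁∧z₂∧z₃≈0 _ (α , β , refl) v = begin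
      val₁ v _
        ≈⟨ val₁-bc1 v α β ⟩
      ∼ ((val₁ v α ∧ val₂ v α) ∧ val₃ v α) ∨ val₁ v β
        ≈⟨ ∨-congʳ (x≈⊥⇒¬x≈⊤ 𝒜 (z₁∧z₂∧z₃≈0 (proj₂ (Valuation.val v α)))) ⟩
      1# ∨ val₁ v β
        ≈⟨ ∨-zeroˡ _ ⟩
      1# ∎

-- Inclusions between the classes.

module _ {𝓑 : TripleMultialgebra a ℓ b r} where
  open TripleMultialgebra 𝓑
  open BooleanAlgebra 𝒜
    using (sym; trans; ∧-congˡ; ¬-cong; ∧-complementʳ)
    renaming (refl to ≈-refl)
  open BooleanAlgebraProperties 𝒜
    using (∧-identityʳ; ∧-idem; ¬-involutive)

  CPLₑ⇒cons : 𝕂-CPLₑ 𝓑 → Validates cons 𝓑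
  CPLₑ⇒cons cpl = from (validates-cons⇔ (𝕂-Ci.swap ci)) λ z∈B →
    let (_ , _ , _ , z₃≈1) = B-sub z∈B in z₃≈1
    where open 𝕂-CPLₑ cpl

  -- With `z ₃` the complement of `z ₁ ∧ z ₂`, the triple meet has the form `x ∧ ∼ x`.
  Ci∩cons⇒mbC : 𝕂-Ci 𝓑 → Validates cons 𝓑 → 𝕂-mbC 𝓑
  Ci∩cons⇒mbC ci valid = record
    { swap  = swap
    ; B-sub = λ z∈B → let (z₁∨z₂≈1 , z₃≈∼) = B-sub z∈B in
        z₁∨z₂≈1 , trans (∧-congˡ z₃≈∼) (∧-complementʳ _)
    }
    where open 𝕂-Ci ci

  module _ (mbc : 𝕂-mbC 𝓑) (valid : Validates cons 𝓑) where
    open 𝕂-mbC mbc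
    open 𝕂-CPL⁺ₑ swap

    mbC∩cons⇒z₃≈1 : B ⊆ λ z → z ₃ ≈ 1#
    mbC∩cons⇒z₃≈1 = to (validates-cons⇔ swap) valid

    -- As `z ₃ ≈ 1#` is the unit of `∧`, it drops out of the triple meet.
    mbC∩cons⇒z₁∧z₂≈0 : B ⊆ λ z → z ₁ ∧ z ₂ ≈ 0#
    mbC∩cons⇒z₁∧z₂≈0 z∈B =
      trans (sym (∧-identityʳ _))
        (trans (∧-congˡ (sym (mbC∩cons⇒z₃≈1 z∈B))) (proj₂ (B-sub z∈B)))

    -- This is the collapse: a snapshot is now `(z ₁ , ∼ z ₁ , 1#)`, determined by its first
    -- coordinate.
    mbC∩cons⇒z₂≈∼z₁ : B ⊆ λ z → z ₂ ≈ ∼ z ₁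
    mbC∩cons⇒z₂≈∼z₁ z∈B =
      complement-unique 𝒜 (proj₁ (B-sub z∈B)) (mbC∩cons⇒z₁∧z₂≈0 z∈B)

    mbC∩cons⇒∼[z₁∧z₂]≈1 : B ⊆ λ z → ∼ (z ₁ ∧ z ₂) ≈ 1#
    mbC∩cons⇒∼[z₁∧z₂]≈1 z∈B = x≈⊥⇒¬x≈⊤ 𝒜 (mbC∩cons⇒z₁∧z₂≈0 z∈B)

    -- Since `u` is also a snapshot, only its first coordinate has to be found:
    -- `u ₁ ≈ z ₃ ≈ 1# ≈ ∼ (z ₁ ∧ z ₂)`. The second is then a double complement.
    mbC∩cons⇒circ-sub : ∀ ((z , z∈B) : Dom) → op₁ circ (z , z∈B) ⊆
      λ u → proj₁ u ≈³ (∼ (z ₁ ∧ z ₂) , z ₁ ∧ z ₂ , 1#)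
    mbC∩cons⇒circ-sub (z , z∈B) {u , u∈B} u∈∘z =
        u₁≈∼[z₁∧z₂]
      , trans (mbC∩cons⇒z₂≈∼z₁ u∈B) (trans (¬-cong u₁≈∼[z₁∧z₂]) (¬-involutive _))
      , mbC∩cons⇒z₃≈1 u∈B
      where
      u₁≈∼[z₁∧z₂] : u ₁ ≈ ∼ (z ₁ ∧ z ₂)
      u₁≈∼[z₁∧z₂] = trans (circ-sub (z , z∈B) u∈∘z)
        (trans (mbC∩cons⇒z₃≈1 z∈B) (sym (mbC∩cons⇒∼[z₁∧z₂]≈1 z∈B)))

    mbC∩cons⇒Ci : 𝕂-Ci 𝓑
    mbC∩cons⇒Ci = record
      { swap    = swap
      ; B-sub   = λ z∈B → proj₁ (B-sub z∈B)
                        , trans (mbC∩cons⇒z₃≈1 z∈B) (sym (mbC∩cons⇒∼[z₁∧z₂]≈1 z∈B))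
      ; circ-eq = λ z → mbC∩cons⇒circ-sub z , ∘z-contains z
      ; neg-sub = neg-sub-≤
      }
      where
      module ≈³ = Setoid tripleSetoid

      -- A nonempty set whose members all equal one triple contains everything equal to it: the
      -- witness `w` is replaced by `u` through `op₁-cong`.
      ∘z-contains : ∀ ((z , z∈B) : Dom) →
        (λ u → proj₁ u ≈³ (∼ (z ₁ ∧ z ₂) , z ₁ ∧ z ₂ , 1#)) ⊆ op₁ circ (z , z∈B)
      ∘z-contains z {u} u≈ with op₁-nonempty circ z
      ... | w , w∈∘z = op₁-cong circ {z} {z} {w} {u} ≈³.refl
        (≈³.trans (mbC∩cons⇒circ-sub z w∈∘z) (≈³.sym u≈)) w∈∘z

      neg-sub-≤ : ∀ ((z , z∈B) : Dom) → op₁ neg (z , z∈B) ⊆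
        λ u → proj₁ u ₁ ≈ z ₂ × proj₁ u ₂ ≤ z ₁
      neg-sub-≤ (z , z∈B) {u , u∈B} u∈¬z =
        -- Here `x ≤ y` unfolds to `x ≈ x ∧ y`. The bound is attained:
        -- `u ₂ ≈ ∼ u ₁ ≈ ∼ z ₂ ≈ ∼ ∼ z ₁ ≈ z ₁`.
        u₁≈z₂ , trans (sym (∧-idem _)) (∧-congˡ u₂≈z₁)
        where
        u₁≈z₂ : u ₁ ≈ z ₂
        u₁≈z₂ = neg-sub (z , z∈B) u∈¬z

        u₂≈z₁ : u ₂ ≈ z ₁
        u₂≈z₁ = trans (mbC∩cons⇒z₂≈∼z₁ u∈B)
          (trans (¬-cong (trans u₁≈z₂ (mbC∩cons⇒z₂≈∼z₁ z∈B))) (¬-involutive _))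

  -- Passing through `𝕂-mbC` makes the collapse of the coordinates available, with `z ₁` as the
  -- parameter of the triple.
  Ci∩cons⇒CPLₑ : 𝕂-Ci 𝓑 → Validates cons 𝓑 → 𝕂-CPLₑ 𝓑
  Ci∩cons⇒CPLₑ ci valid = record
    { ci    = ci
    ; B-sub = λ {z} z∈B → z ₁ , ≈-refl
                        , mbC∩cons⇒z₂≈∼z₁ mbc valid z∈B
                        , mbC∩cons⇒z₃≈1 mbc valid z∈B
    }
    where
    mbc : 𝕂-mbC 𝓑
    mbc = Ci∩cons⇒mbC ci valid

  mbC⇒Ax10 : 𝕂-mbC 𝓑 → Validates Ax10 𝓑
  mbC⇒Ax10 mbc = from (validates-Ax10⇔ swap) λ z∈B → proj₁ (B-sub z∈B)
    where open 𝕂-mbC mbc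

  mbC⇒bc1 : 𝕂-mbC 𝓑 → Validates bc1 𝓑
  mbC⇒bc1 mbc = from (validates-bc1⇔ swap) λ z∈B → proj₂ (B-sub z∈B)
    where open 𝕂-mbC mbc

  CPL⁺ₑ∩Ax10∩bc1⇒mbC : 𝕂-CPL⁺ₑ 𝓑 → Validates Ax10 𝓑 → Validates bc1 𝓑 → 𝕂-mbC 𝓑
  CPL⁺ₑ∩Ax10∩bc1⇒mbC swap ax10 bc = record
    { swap  = swap
    ; B-sub = λ z∈B → to (validates-Ax10⇔ swap) ax10 z∈B
                    , to (validates-bc1⇔ swap) bc z∈B
    }

proposition8p18 : ∀ (a ℓ b r : Level) →
    (𝕂-CPLₑ {a} {ℓ} {b} {r} ≐ 𝕂-Ci ∩ Validates cons)
    × (𝕂-Ci {a} {ℓ} {b} {r} ∩ Validates cons ≐ 𝕂-mbC ∩ Validates cons)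
    × (𝕂-mbC {a} {ℓ} {b} {r} ∩ Validates cons
    ≐ 𝕂-CPL⁺ₑ ∩ Validates Ax10 ∩ Validates bc1 ∩ Validates cons)
proposition8p18 a ℓ b r =
    ( (λ cpl → 𝕂-CPLₑ.ci cpl , CPLₑ⇒cons cpl)
    , (λ (ci , valid) → Ci∩cons⇒CPLₑ ci valid))
  , ( (λ (ci , valid) → Ci∩cons⇒mbC ci valid , valid)
    , (λ (mbc , valid) → mbC∩cons⇒Ci mbc valid , valid))
  , ( (λ (mbc , valid) → 𝕂-mbC.swap mbc , mbC⇒Ax10 mbc , mbC⇒bc1 mbc , valid)
    , (λ (swap , ax10 , bc , valid) → CPL⁺ₑ∩Ax10∩bc1⇒mbC swap ax10 bc , valid))
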